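{- Let $\lambda$ be a cardinal (finite or infinite) and let $G$ be a graph with $\mathrm{col}(G)\le\lambda^+$ which admits a $\lambda$-packing. Then $G$ admits a $\lambda$-decomposition.
   Context: Graphs may be infinite and may have parallel edges, but have no loops. A spanning tree of $G$ is a connected, acyclic subgraph containing all vertices of $G$. A $\lambda$-packing of $G$ is a collection of $\lambda$ many pairwise edge-disjoint spanning trees of $G$; a $\lambda$-decomposition of $G$ is a collection of $\lambda$ many spanning trees of $G$ whose edge sets partition $E(G)$. The colouring number $\mathrm{col}(G)$ of $G=(V,E)$ is the smallest cardinal $\mu$ such that there is a well-ordering $<^*$ of $V$ such that for every $v\in V$ the number of edges (parallel edges counted separately) between $v$ and $\{w\in V: w<^*v\}$ is strictly less than $\mu$. $\lambda^+$ denotes the successor cardinal of $\lambda$ (so $\lambda^+=\lambda+1$ when $\lambda$ is finite). -}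

module Defs where

open import Data.Nat using (ℕ; zero; suc)
open import Data.Fin using (Fin; zero; suc; inject₁; fromℕ)
open import Data.Product using (Σ; _×_; _,_; proj₁; proj₂)
open import Data.Sum using (_⊎_)
open import Relation.Binary.PropositionalEquality using (_≡_; _≢_)
open import Relation.Nullary using (¬_)
open import Data.Empty using (⊥)
open import Induction.WellFounded using (WellFounded)
open import Function.Definitions using (Injective)

record Graph : Set₁ where
  field
    V      : Set
    E      : Set
    ends   : E → V × V
    noLoop : ∀ e → proj₁ (ends e) ≢ proj₂ (ends e)

module _ (G : Graph) where
  open Graph G

  Joins : E → V → V → Set
  Joins e x y = (proj₁ (ends e) ≡ x × proj₂ (ends e) ≡ y)
              ⊎ (proj₁ (ends e) ≡ y × proj₂ (ends e) ≡ x)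

  -- A (spanning) subgraph is given by its edge set, a predicate on E.
  EdgeSet : Set₁
  EdgeSet = E → Set

  record Walk (T : EdgeSet) (u v : V) : Set where
    field
      len   : ℕ
      verts : Fin (suc len) → V
      edges : Fin len → E
      inT   : ∀ i → T (edges i)
      step  : ∀ i → Joins (edges i) (verts (inject₁ i)) (verts (suc i))
      start : verts zero ≡ u
      end   : verts (fromℕ len) ≡ v

  -- a cycle in T: a closed walk with k = n+2 ≥ 2 pairwise distinct edges and
  -- pairwise distinct vertices v₀ … v_{k-1} (v_k = v₀).
  record Cycle (T : EdgeSet) : Set where
    field
      n      : ℕ
      verts  : Fin (suc (suc (suc n))) → V
      edges  : Fin (suc (suc n)) → E
      inT    : ∀ i → T (edges i)
      step   : ∀ i → Joins (edges i) (verts (inject₁ i)) (verts (suc i))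
      closed : verts zero ≡ verts (fromℕ (suc (suc n)))
      vInj   : Injective _≡_ _≡_ (λ (i : Fin (suc (suc n))) → verts (inject₁ i))
      eInj   : Injective _≡_ _≡_ edges

  Connected : EdgeSet → Set
  Connected T = ∀ u v → Walk T u v

  Acyclic : EdgeSet → Set
  Acyclic T = ¬ Cycle T

  SpanningTree : EdgeSet → Set
  SpanningTree T = Connected T × Acyclic T

  Packing : (Λ : Set) → Set₁
  Packing Λ = Σ (Λ → EdgeSet) λ T →
      (∀ i → SpanningTree (T i))
    × (∀ i j → i ≢ j → ∀ e → T i e → T j e → ⊥)

  Decomposition : (Λ : Set) → Set₁
  Decomposition Λ = Σ (Λ → EdgeSet) λ T →
      (∀ i → SpanningTree (T i))
    × (∀ e → Σ Λ λ i → T i e × (∀ j → T j e → j ≡ i))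

  BackEdge : (V → V → Set) → V → E → Set
  BackEdge _<*_ v e = Σ V λ w → (w <* v) × Joins e v w

  record IsWellOrder (_<*_ : V → V → Set) : Set where
    field
      irrefl : ∀ x → ¬ (x <* x)
      trans  : ∀ {x y z} → x <* y → y <* z → x <* z
      total  : ∀ x y → (x <* y) ⊎ (x ≡ y) ⊎ (y <* x)
      wf     : WellFounded _<*_

  -- col(G) ≤ λ⁺ : there is a well-ordering of V such that for every v the
  -- number of back edges at v is < λ⁺, i.e. at most |Λ|, i.e. the set of
  -- back edges at v injects into Λ.
  ColLeSucc : (Λ : Set) → Set₁
  ColLeSucc Λ = Σ (V → V → Set) λ _<*_ → IsWellOrder _<*_ ×
      (∀ v → Σ ((e : E) → BackEdge _<*_ v e → Λ) λ f →
         ∀ e e' p p' → f e p ≡ f e' p' → e ≡ e')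

{-# OPTIONS --safe #-}

-- Colour every edge e by its home: the label in Λ that the well-ordering gives
-- to e among the back edges at the larger end (the top) of e.  For each i order
-- the edges by their top; among edges with equal top those with home i come
-- first, the others are ordered by their smaller end.  Let S be the least set
-- that contains every edge missed by the packing T, and every edge of T i which
-- closes a cycle with smaller edges of H i = T i ∪ {e ∈ S ∣ e has home i}.  The
-- i-th tree of the decomposition is the minimum spanning tree of H i.  An edge
-- with home i is never discarded from H i, since a cycle through its top has a
-- second edge which is larger; so the edges of S end up exactly in their home
-- trees, and all the others stay where the packing had them.

module Submission where

open import Defs
open import Axiom.ExcludedMiddle using (ExcludedMiddle)
open import Level using (0ℓ)
open import Data.Nat using (zero; suc)
open import Data.Fin using (Fin; zero; suc; inject₁; fromℕ)
open import Data.Fin.Properties using (_≟_)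
open import Data.Product using (Σ; ∃; _×_; _,_; proj₁; proj₂)
open import Data.Sum using (_⊎_; inj₁; inj₂; swap)
open import Function using (_∘_)
open import Induction.WellFounded using (Acc; acc; WellFounded)
open import Relation.Binary.Construct.Closure.ReflexiveTransitive
  using (Star; ε; _◅_; _◅◅_; _⋆; reverse)
open import Relation.Binary.PropositionalEquality
  using (_≡_; _≢_; refl; sym; trans; subst; subst₂)
open import Relation.Nullary using (¬_; yes; no; contradiction)
open import Relation.Nullary.Decidable using (decidable-stable)

-- Walks as chains of links, which can be concatenated and refined.

module Links (G : Graph) where
  open Graph G

  Link : EdgeSet G → V → V → Set
  Link P x y = Σ E λ e → P e × Joins G e x y

  Link-sym : ∀ {P x y} → Link P x y → Link P y x
  Link-sym (e , p , j) = e , p , swap j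

  star-ends⇒star-joined : ∀ {P e x y} → Joins G e x y →
    Star (Link P) (proj₁ (ends e)) (proj₂ (ends e)) → Star (Link P) x y
  star-ends⇒star-joined (inj₁ (refl , refl)) s = s
  star-ends⇒star-joined (inj₂ (refl , refl)) s = reverse Link-sym s

  joins-endpoints : ∀ {e x y x′ y′} → Joins G e x y → Joins G e x′ y′ →
    (x ≡ x′ × y ≡ y′) ⊎ (x ≡ y′ × y ≡ x′)
  joins-endpoints (inj₁ (refl , refl)) (inj₁ (p , q)) = inj₁ (p , q)
  joins-endpoints (inj₁ (refl , refl)) (inj₂ (p , q)) = inj₂ (p , q)
  joins-endpoints (inj₂ (refl , refl)) (inj₁ (p , q)) = inj₂ (q , p)
  joins-endpoints (inj₂ (refl , refl)) (inj₂ (p , q)) = inj₁ (q , p)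

  module _ {P : EdgeSet G} where

    path⇒star : ∀ m (verts : Fin (suc m) → V) (edges : Fin m → E) →
      (∀ i → Joins G (edges i) (verts (inject₁ i)) (verts (suc i))) →
      (∀ i → P (edges i)) → Star (Link P) (verts zero) (verts (fromℕ m))
    path⇒star zero    verts edges step inP = ε
    path⇒star (suc m) verts edges step inP =
      (edges zero , inP zero , step zero) ◅
      path⇒star m (verts ∘ suc) (edges ∘ suc) (step ∘ suc) (inP ∘ suc)

    -- Used on a cycle: once the two end vertices agree, the two pieces glue to a detour around edge
    -- `k`.
    path-minus-edge : ∀ m (verts : Fin (suc m) → V) (edges : Fin m → E) →
      (∀ i → Joins G (edges i) (verts (inject₁ i)) (verts (suc i))) →
      ∀ k → (∀ i → i ≢ k → P (edges i)) →
      Star (Link P) (verts zero) (verts (inject₁ k)) ×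
      Star (Link P) (verts (suc k)) (verts (fromℕ m))
    path-minus-edge (suc m) verts edges step zero inP =
      ε , path⇒star m (verts ∘ suc) (edges ∘ suc) (step ∘ suc) (λ i → inP (suc i) λ ())
    path-minus-edge (suc m) verts edges step (suc k) inP
      with path-minus-edge m (verts ∘ suc) (edges ∘ suc) (step ∘ suc) k
             (λ i i≢k → inP (suc i) λ { refl → i≢k refl })
    ... | before , after = (edges zero , inP zero (λ ()) , step zero) ◅ before , after

    walk⇒star : ∀ {u v} → Walk G P u v → Star (Link P) u v
    walk⇒star w = subst₂ (Star (Link P)) start end (path⇒star len verts edges step inT)
      where open Walk w

    star⇒walk : ∀ {u v} → Star (Link P) u v → Walk G P u v
    star⇒walk {u} ε = record
      { len   = 0
      ; verts = λ _ → u
      ; edges = λ ()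
      ; inT   = λ ()
      ; step  = λ ()
      ; start = refl
      ; end   = refl
      }
    star⇒walk {u} ((e , p , j) ◅ s) = record
      { len   = suc W.len
      ; verts = λ { zero → u ; (suc i) → W.verts i }
      ; edges = λ { zero → e ; (suc i) → W.edges i }
      ; inT   = λ { zero → p ; (suc i) → W.inT i }
      ; step  = λ { zero → subst (Joins G e u) (sym W.start) j ; (suc i) → W.step i }
      ; start = refl
      ; end   = W.end
      }
      where module W = Walk (star⇒walk s)

    parallel⇒cycle : ∀ {e e′ x y} → x ≢ y → e ≢ e′ → P e → P e′ →
      Joins G e x y → Joins G e′ x y → Cycle G P
    parallel⇒cycle {e} {e′} {x} {y} x≢y e≢e′ p p′ j j′ = record
      { n      = 0
      ; verts  = λ { zero → x ; (suc zero) → y ; (suc (suc zero)) → x }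
      ; edges  = λ { zero → e ; (suc zero) → e′ }
      ; inT    = λ { zero → p ; (suc zero) → p′ }
      ; step   = λ { zero → j ; (suc zero) → swap j′ }
      ; closed = refl
      ; vInj   = λ { {zero} {zero} _ → refl
                   ; {zero} {suc zero} q → contradiction q x≢y
                   ; {suc zero} {zero} q → contradiction (sym q) x≢y
                   ; {suc zero} {suc zero} _ → refl }
      ; eInj   = λ { {zero} {zero} _ → refl
                   ; {zero} {suc zero} q → contradiction q e≢e′
                   ; {suc zero} {zero} q → contradiction (sym q) e≢e′
                   ; {suc zero} {suc zero} _ → refl }
      }

module _ {A : Set} {_≺_ : A → A → Set} (≺-trans : ∀ {a b c} → a ≺ b → b ≺ c → a ≺ c)
  where

  -- Comparability is asked only within the family, because the edge orders below are total only on
  -- the edges of one `H`.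
  maximum : ∀ {m} (a : Fin (suc m) → A) →
    (∀ i j → i ≢ j → a i ≺ a j ⊎ a j ≺ a i) → ∃ λ k → ∀ i → i ≢ k → a i ≺ a k
  maximum {zero} a total = zero , λ { zero i≢k → contradiction refl i≢k }
  maximum {suc m} a total
    with maximum (a ∘ suc) (λ i j i≢j → total (suc i) (suc j) λ { refl → i≢j refl })
  ... | k , max with total zero (suc k) (λ ())
  ... | inj₁ a₀≺aₖ = suc k , λ { zero _ → a₀≺aₖ
                               ; (suc i) i≢k → max i λ { refl → i≢k refl } }
  ... | inj₂ aₖ≺a₀ = zero , λ { zero i≢k → contradiction refl i≢k ; (suc i) _ → below i }
    where
    below : ∀ i → a (suc i) ≺ a zero
    below i with i ≟ k
    ... | yes refl = aₖ≺a₀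
    ... | no i≢k   = ≺-trans (max i i≢k) aₖ≺a₀

-- Minimum spanning trees for well-founded edge orders.

module MinimumSpanningTree
  (em : ExcludedMiddle 0ℓ) (G : Graph) (H : EdgeSet G)
  (_≺_ : Graph.E G → Graph.E G → Set) (≺-wf : WellFounded _≺_)
  (≺-trans : ∀ {a b c} → a ≺ b → b ≺ c → a ≺ c)
  (≺-total : ∀ {a b} → H a → H b → a ≢ b → a ≺ b ⊎ b ≺ a)
  where
  open Graph G
  open Links G

  Below : E → EdgeSet G
  Below e g = H g × g ≺ e

  Redundant : E → Set
  Redundant e = Star (Link (Below e)) (proj₁ (ends e)) (proj₂ (ends e))

  MST : EdgeSet G
  MST e = H e × ¬ Redundant e

  joins⇒redundant : ∀ {e x y} → Joins G e x y → Star (Link (Below e)) x y → Redundant e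
  joins⇒redundant (inj₁ (refl , refl)) s = s
  joins⇒redundant (inj₂ (refl , refl)) s = reverse Link-sym s

  -- Well-founded induction: a redundant edge is bypassed by smaller edges of `H`, and each of these
  -- is replaced in turn.
  link⇒MST-star : ∀ {e} → Acc _≺_ e → H e → ∀ {x y} → Joins G e x y → Star (Link MST) x y
  link⇒MST-star {e} (acc rs) h j with em {Redundant e}
  ... | no ¬r = (e , (h , ¬r) , j) ◅ ε
  ... | yes r = star-ends⇒star-joined j
    (((λ (g , (hg , g≺e) , jg) → link⇒MST-star (rs g≺e) hg jg) ⋆) r)

  MST-connected : Connected G H → Connected G MST
  MST-connected conn u v = star⇒walk
    (((λ (e , h , j) → link⇒MST-star (≺-wf e) h j) ⋆) (walk⇒star (conn u v)))

  MST-acyclic : Acyclic G MST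
  MST-acyclic C with maximum {_≺_ = _≺_} ≺-trans edges
      (λ i j i≢j → ≺-total (proj₁ (inT i)) (proj₁ (inT j)) (i≢j ∘ eInj))
    where open Cycle C
  -- The rest of the cycle, traversed from `suc k` through the closing vertex to `inject₁ k`, makes
  -- its largest edge redundant.
  ... | k , max = proj₂ (inT k) (joins⇒redundant (swap (step k))
    (proj₂ parts ◅◅
      subst (λ v → Star (Link (Below (edges k))) v (verts (inject₁ k))) closed (proj₁ parts)))
    where
    open Cycle C
    parts = path-minus-edge _ verts edges step k (λ i i≢k → proj₁ (inT i) , max i i≢k)

-- Homes, edge orders and the decomposition.

module Decompose
  (em : ExcludedMiddle 0ℓ) (Λ : Set) (G : Graph)
  (col : ColLeSucc G Λ) (packing : Packing G Λ)
  where
  open Graph G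
  open Links G

  _<*_ = proj₁ col
  open IsWellOrder (proj₁ (proj₂ col)) using (irrefl; total; wf) renaming (trans to <*-trans)

  T = proj₁ packing

  orientation : ∀ e → Σ V λ v → BackEdge G _<*_ v e
  orientation e with total (proj₁ (ends e)) (proj₂ (ends e))
  ... | inj₁ x<y        = _ , _ , x<y , inj₂ (refl , refl)
  ... | inj₂ (inj₁ x≡y) = contradiction x≡y (noLoop e)
  ... | inj₂ (inj₂ y<x) = _ , _ , y<x , inj₁ (refl , refl)

  top low : E → V
  top e = proj₁ (orientation e)
  low e = proj₁ (proj₂ (orientation e))

  low<top : ∀ e → low e <* top e
  low<top e = proj₁ (proj₂ (proj₂ (orientation e)))

  top-joins-low : ∀ e → Joins G e (top e) (low e)
  top-joins-low e = proj₂ (proj₂ (proj₂ (orientation e)))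

  home : E → Λ
  home e = proj₁ (proj₂ (proj₂ col) (top e)) e (proj₂ (orientation e))

  home-injective : ∀ {e e′} → top e ≡ top e′ → home e ≡ home e′ → e ≡ e′
  home-injective {e} {e′} = go (proj₂ (orientation e)) (proj₂ (orientation e′))
    where
    label = λ v → proj₁ (proj₂ (proj₂ col) v)
    -- Abstracting the tops lets their equality be matched, so that both labels come from the same
    -- injection.
    go : ∀ {v v′} (p : BackEdge G _<*_ v e) (p′ : BackEdge G _<*_ v′ e′) →
      v ≡ v′ → label v e p ≡ label v′ e′ p′ → e ≡ e′
    go p p′ refl = proj₂ (proj₂ (proj₂ col) _) e e′ p p′

  endpoint≤top : ∀ {g x y} → Joins G g x y → ¬ (top g <* x)
  endpoint≤top {g} j lt with joins-endpoints j (top-joins-low g)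
  ... | inj₁ (refl , _) = irrefl _ lt
  ... | inj₂ (refl , _) = irrefl _ (<*-trans lt (low<top g))

  -- The conjunct `home e ≢ i` leaves an edge with home `i` no predecessor of equal top.
  Precedes : Λ → E → E → Set
  Precedes i g e = top g <* top e ⊎
    (top g ≡ top e × home e ≢ i × (home g ≡ i ⊎ low g <* low e))

  Precedes-trans : ∀ i {a b c} → Precedes i a b → Precedes i b c → Precedes i a c
  Precedes-trans i (inj₁ p) (inj₁ q) = inj₁ (<*-trans p q)
  Precedes-trans i (inj₁ p) (inj₂ (q , _)) = inj₁ (subst (_ <*_) q p)
  Precedes-trans i (inj₂ (p , _)) (inj₁ q) = inj₁ (subst (_<* _) (sym p) q)
  Precedes-trans i (inj₂ (p , hb , r)) (inj₂ (q , hc , s)) = inj₂ (trans p q , hc , combine r s)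
    where
    combine : _ ⊎ _ → _ ⊎ _ → _ ⊎ _
    combine (inj₁ ha) _          = inj₁ ha
    combine (inj₂ _)  (inj₁ hb≡) = contradiction hb≡ hb
    combine (inj₂ l)  (inj₂ l′)  = inj₂ (<*-trans l l′)

  -- Induction on the top, then on the low end. A predecessor with home `i` and equal top may have a
  -- larger low end, but its own predecessors all have smaller tops.
  Precedes-wf : ∀ i → WellFounded (Precedes i)
  Precedes-wf i e = byTop (wf (top e)) e refl
    where
    byTop : ∀ {v} → Acc _<*_ v → ∀ e → top e ≡ v → Acc (Precedes i) e
    byTop {v} (acc rv) e t≡v = byLow (wf (low e)) e t≡v refl
      where
      lower : ∀ {g} → top g <* v → Acc (Precedes i) g
      lower {g} lt = byTop (rv lt) g refl
      byLow : ∀ {w} → Acc _<*_ w → ∀ e → top e ≡ v → low e ≡ w → Acc (Precedes i) e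
      byLow (acc rw) e refl refl = acc λ
        { (inj₁ lt)                 → lower lt
        ; (inj₂ (t≡ , _ , inj₂ lt)) → byLow (rw lt) _ t≡ refl
        ; (inj₂ (t≡ , _ , inj₁ hg)) → acc λ
          { (inj₁ lt)            → lower (subst (_ <*_) t≡ lt)
          ; (inj₂ (_ , hg≢ , _)) → contradiction hg hg≢ } }

  same-ends⇒≡ : ∀ {i e e′} → T i e → T i e′ → top e ≡ top e′ → low e ≡ low e′ → e ≡ e′
  same-ends⇒≡ {i} {e} {e′} t t′ p q = decidable-stable em λ e≢e′ →
    proj₂ (proj₁ (proj₂ packing) i) (parallel⇒cycle
      (λ top≡low → irrefl _ (subst (_<* top e) (sym top≡low) (low<top e)))
      e≢e′ t t′ (top-joins-low e)
      (subst₂ (Joins G e′) (sym p) (sym q) (top-joins-low e′)))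

  mutual
    -- An inductive definition is possible since redundancy is monotone in `Available`. The
    -- constructors and their inversion give the two directions of the fixed-point equation.
    data Rehomed : E → Set where
      uncovered : ∀ {e} → ¬ ∃ (λ i → T i e) → Rehomed e
      -- The star is M.Redundant i e below, whose module depends on Available.
      discarded : ∀ {i e} → T i e →
        Star (Link λ g → Available i g × Precedes i g e) (proj₁ (ends e)) (proj₂ (ends e)) →
        Rehomed e

    Available : Λ → EdgeSet G
    Available i e = T i e ⊎ (home e ≡ i × Rehomed e)

  -- At equal tops, two edges with home `i` coincide by `home-injective`; two with other homes both
  -- lie in `T i`, and a tree has no parallel edges.
  Precedes-total : ∀ i {a b} → Available i a → Available i b → a ≢ b →
    Precedes i a b ⊎ Precedes i b a
  Precedes-total i {a} {b} ha hb a≢b with total (top a) (top b)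
  ... | inj₁ lt = inj₁ (inj₁ lt)
  ... | inj₂ (inj₂ gt) = inj₂ (inj₁ gt)
  ... | inj₂ (inj₁ t≡) with em {home a ≡ i} | em {home b ≡ i}
  ... | yes p | yes q = contradiction (home-injective t≡ (trans p (sym q))) a≢b
  ... | yes p | no ¬q = inj₁ (inj₂ (t≡ , ¬q , inj₁ p))
  ... | no ¬p | yes q = inj₂ (inj₂ (sym t≡ , ¬p , inj₁ q))
  ... | no ¬p | no ¬q with total (low a) (low b)
  ... | inj₁ lt        = inj₁ (inj₂ (t≡ , ¬q , inj₂ lt))
  ... | inj₂ (inj₂ gt) = inj₂ (inj₂ (sym t≡ , ¬p , inj₂ gt))
  ... | inj₂ (inj₁ l≡) = contradiction (same-ends⇒≡ (inTree ha ¬p) (inTree hb ¬q) t≡ l≡) a≢b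
    where
    inTree : ∀ {e} → Available i e → home e ≢ i → T i e
    inTree (inj₁ t)       _  = t
    inTree (inj₂ (p , _)) ¬p = contradiction p ¬p

  module M (i : Λ) = MinimumSpanningTree em G (Available i) (Precedes i)
    (Precedes-wf i) (Precedes-trans i) (Precedes-total i)

  -- Edges preceding `e` in the order of its home have smaller tops, so none of them meets `top e`
  -- and a detour cannot even start there.
  home-not-redundant : ∀ e → ¬ M.Redundant (home e) e
  home-not-redundant e r =
    noPath (low<top e) (star-ends⇒star-joined (top-joins-low e) r)
    where
    notBelow : ∀ {g y} → Precedes (home e) g e → ¬ Joins G g (top e) y
    notBelow (inj₁ lt)              j = endpoint≤top j lt
    notBelow (inj₂ (_ , home≢ , _)) j = home≢ refl
    noPath : ∀ {z} → z <* top e → ¬ Star (Link (M.Below (home e) e)) (top e) z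
    noPath lt ε                         = irrefl _ lt
    noPath _  ((g , (_ , g≺e) , j) ◅ _) = notBelow g≺e j

  decomposition : Decomposition G Λ
  decomposition = M.MST , spanning , partition
    where
    disjoint : ∀ {i j e} → T i e → T j e → j ≡ i
    disjoint {i} {j} {e} t t′ = decidable-stable em λ j≢i → proj₂ (proj₂ packing) j i j≢i e t′ t

    spanning : ∀ i → SpanningTree G (M.MST i)
    -- `Available i` contains the tree `T i`, hence is connected.
    spanning i = M.MST-connected i (λ u v → include (proj₁ (proj₁ (proj₂ packing) i) u v))
               , M.MST-acyclic i
      where
      include : ∀ {u v} → Walk G (T i) u v → Walk G (Available i) u v
      include w = record { Walk w ; inT = inj₁ ∘ Walk.inT w }

    partition : ∀ e → Σ Λ λ i → M.MST i e × (∀ j → M.MST j e → j ≡ i)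
    partition e with em {Rehomed e} | em {∃ λ i → T i e}
    ... | yes s | _ = home e , (inj₂ (refl , s) , home-not-redundant e) , unique s
      where
      unique : Rehomed e → ∀ j → M.MST j e → j ≡ home e
      unique _ j (inj₂ (p , _) , _) = sym p
      unique (uncovered ¬t) j (inj₁ t , _) = contradiction (j , t) ¬t
      -- Packing trees are disjoint, so `j` is the index whose tree discarded `e`, where `e` is
      -- redundant.
      unique (discarded {i} t r) j (inj₁ t′ , ¬r) with disjoint t t′
      ... | refl = contradiction r ¬r
    ... | no ¬s | no ¬t = contradiction (uncovered ¬t) ¬s
    -- Redundancy in `Available i` would have rehomed `e`, so `e` stays in its packing tree.
    ... | no ¬s | yes (i , t) = i , (inj₁ t , λ r → ¬s (discarded t r)) , unique
      where
      unique : ∀ j → M.MST j e → j ≡ i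
      unique j (inj₁ t′ , _)      = disjoint t t′
      unique j (inj₂ (_ , s) , _) = contradiction s ¬s

theorem3p1 : ExcludedMiddle 0ℓ → (Λ : Set) → (G : Graph) →
    ColLeSucc G Λ → Packing G Λ → Decomposition G Λ
theorem3p1 em Λ G col packing = Decompose.decomposition em Λ G col packing
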